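{- Let $k \ge 2$ be an integer and let $\mu$ be a real number with $1 \le \mu < 2$. Define $r_1 = 1$ and $r_j = r_{j-1}(r_{j-1}+1)$ for $j > 1$. Let $Q$ be the largest integer $j \ge 1$ such that $$r_j \le \left\lceil \frac{1}{\max(\mu-1,\, 1/k)} \right\rceil - 1.$$ Then $$\operatorname{opt}(\mathrm{IP}(k,\mu)) = \sum_{j=1}^{Q+1} \frac{1}{r_j} + \frac{\mu-1}{r_{Q+1}}.$$
   Context: $\operatorname{opt}(\mathrm{IP}(k,\mu))$ denotes the optimal value of the integer program $\mathrm{IP}(k,\mu)$: $$\max_{z \in \mathbb{Z}_{\ge 0}^{k-1}} \ \mu + \sum_{j=1}^{k-1} z_j\left(\frac{1}{j} - \frac{\mu}{j+1}\right) \quad \text{subject to} \quad \sum_{j=1}^{k-1} \frac{z_j}{j+1} < 1.$$ -}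

module Defs where

open import Algebra.Bundles.Raw using (RawMonoid)
import Algebra.Definitions.RawMonoid as Sum
open import Data.Fin.Base using (Fin; toℕ)
open import Data.Integer.Base as ℤ using (ℤ; +_; +[1+_]; -[1+_])
open import Data.Nat.Base as ℕ using (ℕ; suc; NonZero)
import Data.Nat.Properties as ℕ
open import Data.Product.Base using (∃; _×_; _,_)
open import Data.Rational.Base
  using (ℚ; mkℚ; 0ℚ; 1ℚ; ½; _/_; _+_; _*_; _-_; -_; 1/_; ∣_∣; _⊔_; _≤_; _<_;
         positive; nonNegative; +-0-rawMonoid)
open import Data.Rational.Properties
open import Data.Rational.Solver using (module +-*-Solver)
open import Data.Sum.Base using (inj₁; inj₂)
open import Data.Vec.Functional using (Vector)
open import Level using (0ℓ)
open import Relation.Binary.PropositionalEquality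
  using (_≡_; refl; sym; trans; cong; subst; module ≡-Reasoning)

private module E = ≡-Reasoning
open ≤-Reasoning
open +-*-Solver using (solve; con; _:=_; _:+_; _:*_; _:-_; :-_)

private
  -⇒≤ : ∀ {a b e} → ∣ a - b ∣ ≤ e → a ≤ b + e
  -⇒≤ {a} {b} {e} h = begin
    a            ≡⟨ solve 2 (λ a b → a := b :+ (a :- b)) refl a b ⟩
    b + (a - b)  ≤⟨ +-monoʳ-≤ b (≤-trans (p≤∣p∣ (a - b)) h) ⟩
    b + e        ∎
    where
    p≤∣p∣ : ∀ p → p ≤ ∣ p ∣
    p≤∣p∣ p with ≤-total 0ℚ p
    ... | inj₁ 0≤p = ≤-reflexive (sym (0≤p⇒∣p∣≡p 0≤p))
    ... | inj₂ p≤0 = ≤-trans p≤0 (0≤∣p∣ p)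

  ∣-∣-sym : ∀ a b → ∣ a - b ∣ ≡ ∣ b - a ∣
  ∣-∣-sym a b = trans (sym (∣-p∣≡∣p∣ (a - b)))
    (cong ∣_∣ (solve 2 (λ a b → :- (a :- b) := b :- a) refl a b))

  ≤⇒∣-∣ : ∀ {a b e} → a ≤ b + e → b ≤ a + e → ∣ a - b ∣ ≤ e
  ≤⇒∣-∣ {a} {b} {e} a≤ b≤ with ∣p∣≡p∨∣p∣≡-p (a - b)
  ... | inj₁ eq = subst (_≤ e) (sym eq) (begin
    a - b        ≤⟨ +-monoˡ-≤ (- b) a≤ ⟩
    b + e - b    ≡⟨ solve 2 (λ b e → b :+ e :- b := e) refl b e ⟩
    e            ∎)
  ... | inj₂ eq = subst (_≤ e) (sym eq) (begin
    - (a - b)    ≡⟨ solve 2 (λ a b → :- (a :- b) := b :- a) refl a b ⟩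
    b - a        ≤⟨ +-monoˡ-≤ (- a) b≤ ⟩
    a + e - a    ≡⟨ solve 2 (λ a e → a :+ e :- a := e) refl a e ⟩
    e            ∎)

  *-mono-≤ : ∀ {a b c d} → 0ℚ ≤ a → 0ℚ ≤ d → a ≤ b → c ≤ d → a * c ≤ b * d
  *-mono-≤ {a} {b} {c} {d} 0≤a 0≤d a≤b c≤d = ≤-trans
    (*-monoˡ-≤-nonNeg a {{nonNegative 0≤a}} c≤d)
    (*-monoʳ-≤-nonNeg d {{nonNegative 0≤d}} a≤b)

  *-pos : ∀ {a b} → 0ℚ < a → 0ℚ < b → 0ℚ < a * b
  *-pos {a} {b} 0<a 0<b = positive⁻¹ (a * b)
    {{pos*pos⇒pos a {{positive 0<a}} b {{positive 0<b}}}}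

  ≤-max₃ : ∀ {a b c n} → a ℕ.⊔ (b ℕ.⊔ c) ℕ.≤ n → a ℕ.≤ n × b ℕ.≤ n × c ℕ.≤ n
  ≤-max₃ {a} {b} {c} h =
    ℕ.m⊔n≤o⇒m≤o a (b ℕ.⊔ c) h ,
    ℕ.m⊔n≤o⇒m≤o b c (ℕ.m⊔n≤o⇒n≤o a (b ℕ.⊔ c) h) ,
    ℕ.m⊔n≤o⇒n≤o b c (ℕ.m⊔n≤o⇒n≤o a (b ℕ.⊔ c) h)

-- The multiplicative inverse, made total by inverting 0 to 0.
inv : ℚ → ℚ
inv (mkℚ (+ 0)      _ _) = 0ℚ
inv p@(mkℚ +[1+ _ ] _ _) = 1/ p
inv p@(mkℚ -[1+ _ ] _ _) = 1/ p

*-inv : ∀ {p} → 0ℚ < p → p * inv p ≡ 1ℚ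
*-inv {mkℚ (+ 0)    _ _} 0<p with () ← positive 0<p
*-inv {p@(mkℚ +[1+ _ ] _ _)} 0<p = *-inverseʳ p
*-inv {mkℚ -[1+ _ ] _ _} 0<p with () ← positive 0<p

inv-pos : ∀ {p} → 0ℚ < p → 0ℚ < inv p
inv-pos {mkℚ (+ 0)    _ _} 0<p with () ← positive 0<p
inv-pos {p@(mkℚ +[1+ _ ] _ _)} 0<p = positive⁻¹ (1/ p) {{1/pos⇒pos p}}
inv-pos {mkℚ -[1+ _ ] _ _} 0<p with () ← positive 0<p

Eventually : (ℕ → Set) → Set
Eventually P = ∃ λ N → ∀ n → N ℕ.≤ n → P n

IsCauchy : (ℕ → ℚ) → Set
IsCauchy x = ∀ ε → 0ℚ < ε →
  ∃ λ N → ∀ m n → N ℕ.≤ m → N ℕ.≤ n → ∣ x m - x n ∣ ≤ ε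

-- Reals are Cauchy sequences of rationals, considered up to _≃ᴿ_.
record ℝ : Set where
  constructor mkℝ
  field
    seq    : ℕ → ℚ
    cauchy : IsCauchy seq

open ℝ public

infix 4 _≃ᴿ_ _≤ᴿ_ _<ᴿ_

_≃ᴿ_ : ℝ → ℝ → Set
x ≃ᴿ y = ∀ ε → 0ℚ < ε → Eventually λ n → ∣ seq x n - seq y n ∣ ≤ ε

_≤ᴿ_ : ℝ → ℝ → Set
x ≤ᴿ y = ∀ ε → 0ℚ < ε → Eventually λ n → seq x n ≤ seq y n + ε

_<ᴿ_ : ℝ → ℝ → Set
x <ᴿ y = ∃ λ ε → 0ℚ < ε × Eventually λ n → seq x n + ε ≤ seq y n

fromℚ : ℚ → ℝ
fromℚ q = mkℝ (λ _ → q) λ ε 0<ε → 0 , λ _ _ _ _ →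
  subst (λ p → ∣ p ∣ ≤ ε) (sym (+-inverseʳ q)) (<⇒≤ 0<ε)

fromℤ : ℤ → ℝ
fromℤ i = fromℚ (i / 1)

fromℕ : ℕ → ℝ
fromℕ n = fromℤ (+ n)

0ᴿ 1ᴿ : ℝ
0ᴿ = fromℚ 0ℚ
1ᴿ = fromℚ 1ℚ

infixl 6 _+ᴿ_ _-ᴿ_
infixl 7 _*ᴿ_
infix  8 -ᴿ_

_+ᴿ_ : ℝ → ℝ → ℝ
x +ᴿ y = mkℝ (λ n → seq x n + seq y n) λ ε 0<ε →
  let 0<½ε = *-pos {½} {ε} (positive⁻¹ ½) 0<ε
      M , hx = cauchy x (½ * ε) 0<½ε
      N , hy = cauchy y (½ * ε) 0<½ε
  in M ℕ.⊔ N , λ m n m≥ n≥ →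
    bound ε (seq x m) (seq y m) (seq x n) (seq y n)
      (hx m n (ℕ.m⊔n≤o⇒m≤o M N m≥) (ℕ.m⊔n≤o⇒m≤o M N n≥))
      (hy m n (ℕ.m⊔n≤o⇒n≤o M N m≥) (ℕ.m⊔n≤o⇒n≤o M N n≥))
  where
  bound : ∀ ε a b c d → ∣ a - c ∣ ≤ ½ * ε → ∣ b - d ∣ ≤ ½ * ε →
          ∣ (a + b) - (c + d) ∣ ≤ ε
  bound ε a b c d ac bd = begin
    ∣ (a + b) - (c + d) ∣
      ≡⟨ cong ∣_∣ (solve 4 (λ a b c d → (a :+ b) :- (c :+ d) := (a :- c) :+ (b :- d)) refl a b c d) ⟩
    ∣ (a - c) + (b - d) ∣    ≤⟨ ∣p+q∣≤∣p∣+∣q∣ (a - c) (b - d) ⟩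
    ∣ a - c ∣ + ∣ b - d ∣    ≤⟨ +-mono-≤ ac bd ⟩
    ½ * ε + ½ * ε            ≡⟨ sym (*-distribʳ-+ ε ½ ½) ⟩
    1ℚ * ε                   ≡⟨ *-identityˡ ε ⟩
    ε                        ∎

-ᴿ_ : ℝ → ℝ
-ᴿ x = mkℝ (λ n → - seq x n) λ ε 0<ε →
  let N , hx = cauchy x ε 0<ε
  in N , λ m n m≥ n≥ → subst (_≤ ε) (flip (seq x m) (seq x n)) (hx m n m≥ n≥)
  where
  flip : ∀ a b → ∣ a - b ∣ ≡ ∣ - a - - b ∣
  flip a b = trans (∣-∣-sym a b)
    (cong ∣_∣ (solve 2 (λ a b → b :- a := :- a :- :- b) refl a b))

_-ᴿ_ : ℝ → ℝ → ℝ
x -ᴿ y = x +ᴿ (-ᴿ y)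

private
  bounded : ∀ x → ∃ λ B → 0ℚ < B × Eventually λ n → ∣ seq x n ∣ ≤ B
  bounded x =
    let N , h = cauchy x 1ℚ (positive⁻¹ 1ℚ)
    in ∣ seq x N ∣ + 1ℚ ,
       +-mono-≤-< (0≤∣p∣ (seq x N)) (positive⁻¹ 1ℚ) ,
       N , λ n n≥ → bound (seq x n) (seq x N) (h n N n≥ ℕ.≤-refl)
    where
    bound : ∀ a b → ∣ a - b ∣ ≤ 1ℚ → ∣ a ∣ ≤ ∣ b ∣ + 1ℚ
    bound a b h = begin
      ∣ a ∣              ≡⟨ cong ∣_∣ (solve 2 (λ a b → a := b :+ (a :- b)) refl a b) ⟩
      ∣ b + (a - b) ∣    ≤⟨ ∣p+q∣≤∣p∣+∣q∣ b (a - b) ⟩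
      ∣ b ∣ + ∣ a - b ∣  ≤⟨ +-monoʳ-≤ ∣ b ∣ h ⟩
      ∣ b ∣ + 1ℚ         ∎

_*ᴿ_ : ℝ → ℝ → ℝ
x *ᴿ y = mkℝ (λ n → seq x n * seq y n) λ ε 0<ε →
  let A , 0<A , K , x≤A = bounded x
      B , 0<B , L , y≤B = bounded y
      0<A+B = +-mono-< 0<A 0<B
      δ     = inv (A + B) * ε
      0<δ   = *-pos (inv-pos 0<A+B) 0<ε
      M , hx = cauchy x δ 0<δ
      N , hy = cauchy y δ 0<δ
  in (K ℕ.⊔ L) ℕ.⊔ (M ℕ.⊔ N) , λ m n m≥ n≥ →
    let KL≤m , M≤m , N≤m = ≤-max₃ {K ℕ.⊔ L} m≥
        KL≤n , M≤n , N≤n = ≤-max₃ {K ℕ.⊔ L} n≥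
    in bound ε A B 0<A 0<B (seq x m) (seq y m) (seq x n) (seq y n)
         (x≤A m (ℕ.m⊔n≤o⇒m≤o K L KL≤m)) (y≤B n (ℕ.m⊔n≤o⇒n≤o K L KL≤n))
         (hx m n M≤m M≤n) (hy m n N≤m N≤n)
  where
  bound : ∀ ε A B → 0ℚ < A → 0ℚ < B → ∀ a b c d → ∣ a ∣ ≤ A → ∣ d ∣ ≤ B →
          ∣ a - c ∣ ≤ inv (A + B) * ε → ∣ b - d ∣ ≤ inv (A + B) * ε →
          ∣ a * b - c * d ∣ ≤ ε
  bound ε A B 0<A 0<B a b c d a≤A d≤B ac bd = begin
    ∣ a * b - c * d ∣
      ≡⟨ cong ∣_∣ (solve 4 (λ a b c d → a :* b :- c :* d := a :* (b :- d) :+ d :* (a :- c)) refl a b c d) ⟩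
    ∣ a * (b - d) + d * (a - c) ∣
      ≤⟨ ∣p+q∣≤∣p∣+∣q∣ (a * (b - d)) (d * (a - c)) ⟩
    ∣ a * (b - d) ∣ + ∣ d * (a - c) ∣
      ≤⟨ +-mono-≤ (prod a (b - d) a≤A bd) (prod d (a - c) d≤B ac) ⟩
    A * δ + B * δ
      ≡⟨ solve 4 (λ A B i e → A :* (i :* e) :+ B :* (i :* e) := ((A :+ B) :* i) :* e) refl A B (inv (A + B)) ε ⟩
    ((A + B) * inv (A + B)) * ε
      ≡⟨ cong (_* ε) (*-inv (+-mono-< 0<A 0<B)) ⟩
    1ℚ * ε
      ≡⟨ *-identityˡ ε ⟩
    ε ∎
    where
    δ = inv (A + B) * ε
    prod : ∀ p q {P} → ∣ p ∣ ≤ P → ∣ q ∣ ≤ δ → ∣ p * q ∣ ≤ P * δ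
    prod p q {P} hp hq = subst (_≤ P * δ) (sym (∣p*q∣≡∣p∣*∣q∣ p q))
      (*-mono-≤ (0≤∣p∣ p) (≤-trans (0≤∣p∣ q) hq) hp hq)

_⊔ᴿ_ : ℝ → ℝ → ℝ
x ⊔ᴿ y = mkℝ (λ n → seq x n ⊔ seq y n) λ ε 0<ε →
  let M , hx = cauchy x ε 0<ε
      N , hy = cauchy y ε 0<ε
  in M ℕ.⊔ N , λ m n m≥ n≥ →
    let x≈ = hx m n (ℕ.m⊔n≤o⇒m≤o M N m≥) (ℕ.m⊔n≤o⇒m≤o M N n≥)
        y≈ = hy m n (ℕ.m⊔n≤o⇒n≤o M N m≥) (ℕ.m⊔n≤o⇒n≤o M N n≥)
    in ≤⇒∣-∣
         (bound (seq x m) (seq y m) (seq x n) (seq y n) x≈ y≈)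
         (bound (seq x n) (seq y n) (seq x m) (seq y m)
           (subst (_≤ ε) (∣-∣-sym (seq x m) (seq x n)) x≈)
           (subst (_≤ ε) (∣-∣-sym (seq y m) (seq y n)) y≈))
  where
  bound : ∀ {ε} a b c d → ∣ a - c ∣ ≤ ε → ∣ b - d ∣ ≤ ε → a ⊔ b ≤ (c ⊔ d) + ε
  bound {ε} a b c d ac bd = ⊔-lub
    (≤-trans (-⇒≤ {a} {c} ac) (+-monoˡ-≤ ε (p≤p⊔q c d)))
    (≤-trans (-⇒≤ {b} {d} bd) (+-monoˡ-≤ ε (p≤q⊔p c d)))

-- Finitely many terms of a positive real may vanish, whence the total inverse.
recip : (x : ℝ) → 0ᴿ <ᴿ x → ℝ
recip x (δ , 0<δ , K , δ≤x) = mkℝ (λ n → inv (seq x n)) λ ε 0<ε →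
  let N , hx = cauchy x (ε * (δ * δ)) (*-pos 0<ε (*-pos 0<δ 0<δ))
  in K ℕ.⊔ N , λ m n m≥ n≥ →
    bound ε (seq x m) (seq x n)
      (δ≤ (δ≤x m (ℕ.m⊔n≤o⇒m≤o K N m≥))) (δ≤ (δ≤x n (ℕ.m⊔n≤o⇒m≤o K N n≥)))
      (hx m n (ℕ.m⊔n≤o⇒n≤o K N m≥) (ℕ.m⊔n≤o⇒n≤o K N n≥))
  where
  δ≤ : ∀ {a} → 0ℚ + δ ≤ a → δ ≤ a
  δ≤ {a} = subst (_≤ a) (+-identityˡ δ)

  δ*inv≤1 : ∀ {a} → δ ≤ a → δ * inv a ≤ 1ℚ
  δ*inv≤1 {a} δ≤a = subst (δ * inv a ≤_) (*-inv 0<a)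
    (*-monoʳ-≤-nonNeg (inv a) {{nonNegative (<⇒≤ (inv-pos 0<a))}} δ≤a)
    where 0<a = <-≤-trans 0<δ δ≤a

  bound : ∀ ε a b → δ ≤ a → δ ≤ b → ∣ a - b ∣ ≤ ε * (δ * δ) →
          ∣ inv a - inv b ∣ ≤ ε
  bound ε a b δ≤a δ≤b h = begin
    ∣ inv a - inv b ∣
      ≡⟨ cong ∣_∣ difference ⟩
    ∣ (inv a * inv b) * (b - a) ∣
      ≡⟨ ∣p*q∣≡∣p∣*∣q∣ (inv a * inv b) (b - a) ⟩
    ∣ inv a * inv b ∣ * ∣ b - a ∣
      ≡⟨ cong (_* ∣ b - a ∣) (0≤p⇒∣p∣≡p 0≤ab) ⟩
    (inv a * inv b) * ∣ b - a ∣
      ≤⟨ *-monoˡ-≤-nonNeg (inv a * inv b) {{nonNegative 0≤ab}} (subst (_≤ ε * (δ * δ)) (∣-∣-sym a b) h) ⟩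
    (inv a * inv b) * (ε * (δ * δ))
      ≡⟨ solve 4 (λ i j e d → (i :* j) :* (e :* (d :* d)) := ((d :* i) :* (d :* j)) :* e) refl (inv a) (inv b) ε δ ⟩
    ((δ * inv a) * (δ * inv b)) * ε
      ≤⟨ *-monoʳ-≤-nonNeg ε {{nonNegative 0≤ε}} (*-mono-≤ (<⇒≤ (*-pos 0<δ 0<ia)) (<⇒≤ (positive⁻¹ 1ℚ)) (δ*inv≤1 δ≤a) (δ*inv≤1 δ≤b)) ⟩
    1ℚ * ε
      ≡⟨ *-identityˡ ε ⟩
    ε ∎
    where
    0<a = <-≤-trans 0<δ δ≤a
    0<b = <-≤-trans 0<δ δ≤b
    0<ia = inv-pos 0<a
    0≤ab = <⇒≤ (*-pos 0<ia (inv-pos 0<b))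
    0≤ε : 0ℚ ≤ ε
    0≤ε = *-cancelʳ-≤-pos (δ * δ) {{positive (*-pos 0<δ 0<δ)}}
      (subst (_≤ ε * (δ * δ)) (sym (*-zeroˡ (δ * δ))) (≤-trans (0≤∣p∣ (a - b)) h))
    difference : inv a - inv b ≡ (inv a * inv b) * (b - a)
    difference = E.begin
      inv a - inv b
        E.≡⟨ solve 2 (λ i j → i :- j := i :* con 1ℚ :- j :* con 1ℚ) refl (inv a) (inv b) ⟩
      inv a * 1ℚ - inv b * 1ℚ
        E.≡⟨ cong (λ t → inv a * t - inv b * 1ℚ) (sym (*-inv 0<b)) ⟩
      inv a * (b * inv b) - inv b * 1ℚ
        E.≡⟨ cong (λ t → inv a * (b * inv b) - inv b * t) (sym (*-inv 0<a)) ⟩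
      inv a * (b * inv b) - inv b * (a * inv a)
        E.≡⟨ solve 4 (λ a b i j → i :* (b :* j) :- j :* (a :* i) := (i :* j) :* (b :- a)) refl a b (inv a) (inv b) ⟩
      (inv a * inv b) * (b - a) E.∎

*-recip : ∀ x 0<x → (x *ᴿ recip x 0<x) ≃ᴿ 1ᴿ
*-recip x (δ , 0<δ , K , δ≤x) ε 0<ε = K , λ n n≥ →
  subst (λ p → ∣ p - 1ℚ ∣ ≤ ε)
    (sym (*-inv (<-≤-trans 0<δ (subst (_≤ seq x n) (+-identityˡ δ) (δ≤x n n≥)))))
    (<⇒≤ 0<ε)

IsCeiling : ℝ → ℤ → Set
IsCeiling x c = x ≤ᴿ fromℤ c × (∀ d → x ≤ᴿ fromℤ d → c ℤ.≤ d)

+ᴿ-0-rawMonoid : RawMonoid 0ℓ 0ℓ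
+ᴿ-0-rawMonoid = record { Carrier = ℝ ; _≈_ = _≃ᴿ_ ; _∙_ = _+ᴿ_ ; ε = 0ᴿ }

sumᴿ : ∀ {n} → Vector ℝ n → ℝ
sumᴿ = Sum.sum +ᴿ-0-rawMonoid

sumℚ : ∀ {n} → Vector ℚ n → ℚ
sumℚ = Sum.sum +-0-rawMonoid

IsMaximum : {A : Set} → (A → Set) → (A → ℝ) → ℝ → Set
IsMaximum {A} Feasible f v =
  (∃ λ a → Feasible a × f a ≃ᴿ v) × (∀ a → Feasible a → f a ≤ᴿ v)

IsLargest : (ℕ → Set) → ℕ → Set
IsLargest P n = P n × (∀ m → P m → m ℕ.≤ n)

1/ᴿ_ : (n : ℕ) .{{_ : NonZero n}} → ℝ
1/ᴿ n = fromℚ (+ 1 / n)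

-- A vector z has entries z_1, …, z_{k-1}; the entry at i : Fin (k ∸ 1) is z_j
-- with j as follows.
index : ∀ {n} → Fin n → ℕ
index i = suc (toℕ i)

Feasible : (k : ℕ) → Vector ℕ (k ℕ.∸ 1) → Set
Feasible k z = sumℚ (λ i → + z i / suc (index i)) < 1ℚ

objective : (k : ℕ) → ℝ → Vector ℕ (k ℕ.∸ 1) → ℝ
objective k μ z =
  μ +ᴿ sumᴿ (λ i → fromℕ (z i) *ᴿ (1/ᴿ index i -ᴿ μ *ᴿ (1/ᴿ suc (index i))))

opt-IP[_,_]≃_ : ℕ → ℝ → ℝ → Set
opt-IP[ k , μ ]≃ v = IsMaximum (Feasible k) (objective k μ) v

-- The sequence starts at index 1; the value at 0 is a placeholder.
r : ℕ → ℕ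
r 0             = 1
r 1             = 1
r (suc (suc j)) = r (suc j) ℕ.* (r (suc j) ℕ.+ 1)

r-nonZero : ∀ j → NonZero (r j)
r-nonZero 0             = _
r-nonZero 1             = _
r-nonZero (suc (suc j)) = ℕ.m*n≢0 (r (suc j)) (r (suc j) ℕ.+ 1)
  {{r-nonZero (suc j)}} {{ℕ.≢-nonZero λ eq → ℕ.1+n≢0 (trans (ℕ.+-comm 1 (r (suc j))) eq)}}

1/r : ℕ → ℝ
1/r j = (1/ᴿ r j) {{r-nonZero j}}

threshold : ℝ → (k : ℕ) .{{_ : NonZero k}} → ℝ
threshold μ k = (μ -ᴿ 1ᴿ) ⊔ᴿ (1/ᴿ k)

threshold-pos : ∀ μ k .{{_ : NonZero k}} → 0ᴿ <ᴿ threshold μ k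
threshold-pos μ k = + 1 / k , positive⁻¹ (+ 1 / k) {{normalize-pos 1 k}} , 0 ,
  λ n _ → subst (_≤ seq (threshold μ k) n) (sym (+-identityˡ (+ 1 / k)))
    (p≤q⊔p (seq μ n - 1ℚ) (+ 1 / k))

closedForm : ℝ → ℕ → ℝ
closedForm μ Q =
  sumᴿ {suc Q} (λ i → 1/r (index i)) +ᴿ (μ -ᴿ 1ᴿ) *ᴿ 1/r (suc Q)

{-# OPTIONS --safe #-}

-- An item of kind j has size 1/(j+1) and value 1/j, and capacity left over is
-- worth μ per unit. Since 1/(r(r+1)) = 1/r - 1/(r+1), a bin of capacity 1/r(j)
-- from which an item of kind r(j) is removed becomes a bin of capacity
-- 1/r(j+1). Taking that item is optimal as long as r(j) ≤ 1/(μ-1): without it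
-- every item in the bin has kind > r(j), hence density ≤ 1 + 1/(r(j)+1), and
-- filling 1/r(j) at this density gains no more than the item of kind r(j)
-- together with the remaining 1/r(j+1) at density μ ≥ 1. For j > Q no item that
-- still fits has positive profit.
--
-- The comparison is carried out for rational densities. It transfers to real μ
-- because both sides are 1-Lipschitz in the density and every term of the
-- Cauchy sequence is eventually close to the rational interval allowed by the
-- ceiling hypothesis.

module Submission where

open import Defs
open import Data.Fin.Base using (Fin; zero; suc; toℕ; fromℕ<)
open import Data.Fin.Properties using (toℕ-fromℕ<; toℕ<n; toℕ-injective)
open import Data.Integer.Base as ℤ using (ℤ; +_; -[1+_]; 1ℤ)
import Data.Integer.Properties as ℤ
open import Data.Nat.Base as ℕ using (ℕ; zero; suc; NonZero; z≤n; s≤s)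
import Data.Nat.Properties as ℕ
open import Data.Product.Base using (_×_; _,_; ∃; proj₁; proj₂)
open import Data.Rational.Base
  using (ℚ; 0ℚ; 1ℚ; ½; _/_; _+_; _*_; _-_; -_; ∣_∣; _⊔_; _⊓_; _≤_; _<_;
         nonNegative; positive; toℚᵘ)
open import Data.Rational.Properties
open import Data.Rational.Solver using (module +-*-Solver)
open import Data.Rational.Unnormalised.Base as ℚᵘ using (mkℚᵘ; *≡*)
import Data.Rational.Unnormalised.Properties as ℚᵘ
open import Data.Sum.Base using (_⊎_; inj₁; inj₂)
open import Data.Vec.Functional using (Vector; updateAt)
open import Function.Base using (_∘_)
open import Relation.Binary.PropositionalEquality
  using (_≡_; refl; sym; trans; cong; cong₂; subst; subst₂; module ≡-Reasoning)
open import Relation.Nullary using (¬_; Dec; yes; no; contradiction)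
open import Relation.Nullary.Decidable using (from-yes)

open +-*-Solver using (solve; con; _:=_; _:+_; _:*_; _:-_; :-_)

private module E = ≡-Reasoning

-- Natural numbers and unit fractions as rationals.

opaque
  ι : ℕ → ℚ
  ι n = + n / 1

  -- Setting 1/0 to 0 keeps nonnegativity unconditional, so no `NonZero` argument travels through
  -- the sums.
  u : ℕ → ℚ
  u 0       = 0ℚ
  u (suc n) = + 1 / suc n

  ι≡/1 : ∀ n → ι n ≡ + n / 1
  ι≡/1 n = refl

  ι0≡0 : ι 0 ≡ 0ℚ
  ι0≡0 = refl

  u1≡1 : u 1 ≡ 1ℚ
  u1≡1 = refl

  1/≡u : ∀ n .{{_ : NonZero n}} → + 1 / n ≡ u n
  1/≡u (suc n) = refl

  /≡ι*u : ∀ m n → + m / suc n ≡ ι m * u (suc n)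
  /≡ι*u m n = toℚᵘ-injective (begin-equality
    toℚᵘ (+ m / suc n)              ≃⟨ toℚᵘ-fromℚᵘ (mkℚᵘ (+ m) n) ⟩
    mkℚᵘ (+ m) n
      ≃⟨ *≡* (cong₂ ℤ._*_ (sym (ℤ.*-identityʳ (+ m))) (cong +_ (ℕ.*-identityˡ (suc n)))) ⟩
    mkℚᵘ (+ m) 0 ℚᵘ.* mkℚᵘ (+ 1) n
      ≃⟨ ℚᵘ.*-cong (toℚᵘ-fromℚᵘ (mkℚᵘ (+ m) 0)) (toℚᵘ-fromℚᵘ (mkℚᵘ (+ 1) n)) ⟨
    toℚᵘ (ι m) ℚᵘ.* toℚᵘ (u (suc n)) ≃⟨ toℚᵘ-homo-* (ι m) (u (suc n)) ⟨
    toℚᵘ (ι m * u (suc n))          ∎)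
    where open ℚᵘ.≤-Reasoning

  ι-suc : ∀ n → ι (suc n) ≡ 1ℚ + ι n
  ι-suc n = toℚᵘ-injective (begin-equality
    toℚᵘ (ι (suc n))              ≃⟨ toℚᵘ-fromℚᵘ (mkℚᵘ (+ suc n) 0) ⟩
    mkℚᵘ (+ suc n) 0
      ≃⟨ *≡* (cong (λ i → (+ 1 ℤ.+ i) ℤ.* + 1) (sym (ℤ.*-identityʳ (+ n)))) ⟩
    mkℚᵘ (+ 1) 0 ℚᵘ.+ mkℚᵘ (+ n) 0 ≃⟨ ℚᵘ.+-congʳ (mkℚᵘ (+ 1) 0) (toℚᵘ-fromℚᵘ (mkℚᵘ (+ n) 0)) ⟨
    toℚᵘ 1ℚ ℚᵘ.+ toℚᵘ (ι n)       ≃⟨ toℚᵘ-homo-+ 1ℚ (ι n) ⟨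
    toℚᵘ (1ℚ + ι n)               ∎)
    where open ℚᵘ.≤-Reasoning

  0≤ι : ∀ n → 0ℚ ≤ ι n
  0≤ι n = nonNegative⁻¹ (ι n) {{normalize-nonNeg n 1}}

  0<u : ∀ {n} → 1 ℕ.≤ n → 0ℚ < u n
  0<u {suc n} _ = positive⁻¹ (u (suc n)) {{normalize-pos 1 (suc n)}}

  0≤u : ∀ n → 0ℚ ≤ u n
  0≤u zero    = ≤-refl
  0≤u (suc n) = nonNegative⁻¹ (u (suc n)) {{normalize-nonNeg 1 (suc n)}}

  u-product : ∀ {n} → 1 ℕ.≤ n → u (n ℕ.* suc n) ≡ u n * u (suc n)
  u-product {suc n} _ = toℚᵘ-injective (begin-equality
    toℚᵘ (u (suc n ℕ.* (2 ℕ.+ n)))            ≃⟨ toℚᵘ-fromℚᵘ (mkℚᵘ (+ 1) _) ⟩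
    mkℚᵘ (+ 1) n ℚᵘ.* mkℚᵘ (+ 1) (suc n)
      ≃⟨ ℚᵘ.*-cong (toℚᵘ-fromℚᵘ (mkℚᵘ (+ 1) n)) (toℚᵘ-fromℚᵘ (mkℚᵘ (+ 1) (suc n))) ⟨
    toℚᵘ (u (suc n)) ℚᵘ.* toℚᵘ (u (2 ℕ.+ n))  ≃⟨ toℚᵘ-homo-* (u (suc n)) (u (2 ℕ.+ n)) ⟨
    toℚᵘ (u (suc n) * u (2 ℕ.+ n))            ∎)
    where open ℚᵘ.≤-Reasoning

ι*u : ∀ n → ι (suc n) * u (suc n) ≡ 1ℚ
ι*u n = trans (sym (/≡ι*u (suc n) n))
  (fromℚᵘ-cong {mkℚᵘ (+ suc n) n} {mkℚᵘ (+ 1) 0} (*≡* (ℤ.*-comm (+ suc n) (+ 1))))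

*-monoˡ : ∀ {p q r} → 0ℚ ≤ r → p ≤ q → r * p ≤ r * q
*-monoˡ {r = r} 0≤r = *-monoˡ-≤-nonNeg r {{nonNegative 0≤r}}

*-monoʳ : ∀ {p q r} → 0ℚ ≤ r → p ≤ q → p * r ≤ q * r
*-monoʳ {r = r} 0≤r = *-monoʳ-≤-nonNeg r {{nonNegative 0≤r}}

p≤r+p : ∀ {p r} → 0ℚ ≤ r → p ≤ r + p
p≤r+p {p} {r} 0≤r = subst (_≤ r + p) (+-identityˡ p) (+-monoˡ-≤ p 0≤r)

*-nonNeg : ∀ {p q} → 0ℚ ≤ p → 0ℚ ≤ q → 0ℚ ≤ p * q
*-nonNeg {p} {q} 0≤p 0≤q = subst (_≤ p * q) (*-zeroʳ p) (*-monoˡ 0≤p 0≤q)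

-- Insert 1 = (n+1) · 1/(n+1). Read as a statement about items, the density of kind n is 1 + 1/n.
u-telescope : ∀ {n} → 1 ℕ.≤ n → u n ≡ (1ℚ + u n) * u (suc n)
u-telescope {suc n} _ = E.begin
  a                      E.≡⟨ *-identityʳ a ⟨
  a * 1ℚ                 E.≡⟨ cong (a *_) (ι*u (suc n)) ⟨
  a * (ι (2 ℕ.+ n) * b)  E.≡⟨ cong (λ x → a * (x * b)) (ι-suc (suc n)) ⟩
  a * ((1ℚ + x) * b)
    E.≡⟨ solve 3 (λ a b x → a :* ((con 1ℚ :+ x) :* b) := (x :* a :+ a) :* b) refl a b x ⟩
  (x * a + a) * b        E.≡⟨ cong (λ y → (y + a) * b) (ι*u n) ⟩
  (1ℚ + a) * b           E.∎
  where
  a = u (suc n)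
  b = u (2 ℕ.+ n)
  x = ι (suc n)

u-suc-≤ : ∀ {n} → 1 ℕ.≤ n → u (suc n) ≤ u n
u-suc-≤ {n} 1≤n = begin
  u (suc n)                ≡⟨ *-identityˡ _ ⟨
  1ℚ * u (suc n)
    ≤⟨ *-monoʳ (0≤u (suc n)) (≤-trans (p≤r+p (0≤u n)) (≤-reflexive (+-comm (u n) 1ℚ))) ⟩
  (1ℚ + u n) * u (suc n)   ≡⟨ u-telescope 1≤n ⟨
  u n                      ∎
  where open ≤-Reasoning

u-antitone : ∀ {m n} → 1 ℕ.≤ m → m ℕ.≤ n → u n ≤ u m
u-antitone {m} 1≤m = go ∘ ℕ.≤⇒≤′
  where
  go : ∀ {n} → m ℕ.≤′ n → u n ≤ u m
  go ℕ.≤′-refl       = ≤-refl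
  go (ℕ.≤′-step m≤n) =
    ≤-trans (u-suc-≤ (ℕ.≤-trans 1≤m (ℕ.≤′⇒≤ m≤n))) (go m≤n)

-- Weighted sums over packings.

infix 8 _·_
_·_ : ∀ {n} → Vector ℕ n → Vector ℚ n → ℚ
z · w = sumℚ (λ i → ι (z i) * w i)

sumℚ-cong : ∀ {n} {v w : Vector ℚ n} → (∀ i → v i ≡ w i) → sumℚ v ≡ sumℚ w
sumℚ-cong {zero}  v≡w = refl
sumℚ-cong {suc n} v≡w = cong₂ _+_ (v≡w zero) (sumℚ-cong (v≡w ∘ suc))

sumℚ-mono : ∀ {n} {v w : Vector ℚ n} → (∀ i → v i ≤ w i) → sumℚ v ≤ sumℚ w
sumℚ-mono {zero}  v≤w = ≤-refl
sumℚ-mono {suc n} v≤w = +-mono-≤ (v≤w zero) (sumℚ-mono (v≤w ∘ suc))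

·-scale : ∀ {n} (z : Vector ℕ n) c w → z · (λ i → c * w i) ≡ c * z · w
·-scale {zero}  z c w = sym (*-zeroʳ c)
·-scale {suc n} z c w = E.begin
  ι (z zero) * (c * w zero) + (z ∘ suc) · (λ i → c * w (suc i))
    E.≡⟨ cong (_+_ (ι (z zero) * (c * w zero))) (·-scale (z ∘ suc) c (w ∘ suc)) ⟩
  ι (z zero) * (c * w zero) + c * (z ∘ suc) · (w ∘ suc)
    E.≡⟨ solve 4 (λ a b c d → a :* (c :* b) :+ c :* d := c :* (a :* b :+ d)) refl (ι (z zero)) (w zero) c ((z ∘ suc) · (w ∘ suc)) ⟩
  c * (ι (z zero) * w zero + (z ∘ suc) · (w ∘ suc)) E.∎

·-nonNeg : ∀ {n} (z : Vector ℕ n) {w} → (∀ i → 0ℚ ≤ w i) → 0ℚ ≤ z · w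
·-nonNeg {zero}  z 0≤w = ≤-refl
·-nonNeg {suc n} z 0≤w =
  +-mono-≤ (*-nonNeg (0≤ι (z zero)) (0≤w zero)) (·-nonNeg (z ∘ suc) (0≤w ∘ suc))

·-zero : ∀ {n} (w : Vector ℚ n) → (λ _ → 0) · w ≡ 0ℚ
·-zero {zero}  w = refl
·-zero {suc n} w = trans (cong₂ _+_ (trans (cong (_* w zero) ι0≡0) (*-zeroˡ (w zero))) (·-zero (w ∘ suc))) (+-identityˡ 0ℚ)

-- `e` is the signed change of multiplicity, so that adding a copy (`e` = 1) and removing one (`e` =
-- -1) are both instances.
·-updateAt : ∀ {n} (z : Vector ℕ n) p f e w → ι (f (z p)) ≡ e + ι (z p) →
             updateAt z p f · w ≡ e * w p + z · w
·-updateAt {suc n} z zero f e w eq = E.begin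
  ι (f (z zero)) * w zero + s      E.≡⟨ cong (λ x → x * w zero + s) eq ⟩
  (e + ι (z zero)) * w zero + s
    E.≡⟨ solve 4 (λ a b e s → (e :+ a) :* b :+ s := e :* b :+ (a :* b :+ s)) refl (ι (z zero)) (w zero) e s ⟩
  e * w zero + (ι (z zero) * w zero + s) E.∎
  where s = (z ∘ suc) · (w ∘ suc)
·-updateAt {suc n} z (suc p) f e w eq = E.begin
  h + updateAt (z ∘ suc) p f · (w ∘ suc)
    E.≡⟨ cong (_+_ h) (·-updateAt (z ∘ suc) p f e (w ∘ suc) eq) ⟩
  h + (e * w (suc p) + s)
    E.≡⟨ solve 3 (λ h x s → h :+ (x :+ s) := x :+ (h :+ s)) refl h (e * w (suc p)) s ⟩
  e * w (suc p) + (h + s)                 E.∎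
  where
  h = ι (z zero) * w zero
  s = (z ∘ suc) · (w ∘ suc)

·-add : ∀ {n} (z : Vector ℕ n) p w → updateAt z p suc · w ≡ w p + z · w
·-add z p w = trans (·-updateAt z p suc 1ℚ w (ι-suc (z p))) (cong (_+ z · w) (*-identityˡ (w p)))

·-remove : ∀ {n} (z : Vector ℕ n) p w {m} → z p ≡ suc m →
           z · w ≡ w p + updateAt z p ℕ.pred · w
·-remove z p w {m} eq = E.begin
  z · w
    E.≡⟨ solve 2 (λ x y → x := y :+ (:- con 1ℚ :* y :+ x)) refl (z · w) (w p) ⟩
  w p + ((- 1ℚ) * w p + z · w)         E.≡⟨ cong (_+_ (w p)) (·-updateAt z p ℕ.pred (- 1ℚ) w eq′) ⟨
  w p + updateAt z p ℕ.pred · w        E.∎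
  where
  eq′ : ι (ℕ.pred (z p)) ≡ (- 1ℚ) + ι (z p)
  eq′ rewrite eq | ι-suc m = solve 1 (λ x → x := :- con 1ℚ :+ (con 1ℚ :+ x)) refl (ι m)

-- A single copy of `p` would already contribute `b`, and the other terms are nonnegative. This
-- excludes kinds too large for the bin.
·-<⇒≡0 : ∀ {n} (z : Vector ℕ n) {w b} → (∀ i → 0ℚ ≤ w i) → z · w < b →
         ∀ p → b ≤ w p → z p ≡ 0
·-<⇒≡0 z {w} {b} 0≤w s<b p b≤w with z p in eq
... | zero  = refl
... | suc m = contradiction (begin-strict
  z · w                              <⟨ s<b ⟩
  b                                  ≤⟨ b≤w ⟩
  w p                                ≤⟨ p≤r+p (·-nonNeg (updateAt z p ℕ.pred) 0≤w) ⟩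
  updateAt z p ℕ.pred · w + w p      ≡⟨ +-comm _ (w p) ⟩
  w p + updateAt z p ℕ.pred · w      ≡⟨ ·-remove z p w eq ⟨
  z · w                              ∎) (<-irrefl refl)
  where open ≤-Reasoning

·-affine : ∀ {n} (z : Vector ℕ n) v q w →
           z · (λ i → v i - q * w i) ≡ z · v - q * z · w
·-affine {zero}  z v q w = solve 1 (λ q → con 0ℚ := con 0ℚ :- q :* con 0ℚ) refl q
·-affine {suc n} z v q w = E.begin
  a * (v zero - q * w zero) + (z ∘ suc) · (λ i → v (suc i) - q * w (suc i))
    E.≡⟨ cong (_+_ (a * (v zero - q * w zero))) (·-affine (z ∘ suc) (v ∘ suc) q (w ∘ suc)) ⟩
  a * (v zero - q * w zero) + (s - q * t)
    E.≡⟨ solve 6 (λ a x q y s t → a :* (x :- q :* y) :+ (s :- q :* t) := (a :* x :+ s) :- q :* (a :* y :+ t)) refl a (v zero) q (w zero) s t ⟩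
  (a * v zero + s) - q * (a * w zero + t) E.∎
  where
  a = ι (z zero)
  s = (z ∘ suc) · (v ∘ suc)
  t = (z ∘ suc) · (w ∘ suc)

-- Greedy packings along a Sylvester sequence.

size : ℕ → ℚ
size j = u (suc j)

-- The gain over leaving the item's capacity free at density `q`.
profit : ℚ → ℕ → ℚ
profit q j = u j - q * size j

-- Only the recursion is fixed, not the first term, so that inductions can pass to the tail, that
-- is, to a smaller bin.
Sylvester : (ℕ → ℕ) → Set
Sylvester ρ = (∀ j → 1 ℕ.≤ ρ j) × (∀ j → ρ (suc j) ≡ ρ j ℕ.* (ρ j ℕ.+ 1))

tail-Sylvester : ∀ {ρ} → Sylvester ρ → Sylvester (ρ ∘ suc)
tail-Sylvester (pos , step) = pos ∘ suc , step ∘ suc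

-- One item of each kind ρ 0, …, ρ (d - 1) in a bin of capacity 1/ρ(0) leaves
-- 1/ρ(d) to be filled at density q.
greedyValue : ℚ → (ℕ → ℕ) → ℕ → ℚ
greedyValue q ρ zero    = q * u (ρ 0)
greedyValue q ρ (suc d) = u (ρ 0) + greedyValue q (ρ ∘ suc) d

-- The last unit fraction 1/ρ(d) of the sum merges with (q-1)/ρ(d) into q/ρ(d).
greedyValue-sum : ∀ q ρ d →
  sumℚ {suc d} (λ i → u (ρ (toℕ i))) + (q - 1ℚ) * u (ρ d) ≡ greedyValue q ρ d
greedyValue-sum q ρ zero =
  solve 2 (λ q a → (a :+ con 0ℚ) :+ (q :- con 1ℚ) :* a := q :* a) refl q (u (ρ 0))
greedyValue-sum q ρ (suc d) = trans
  (+-assoc (u (ρ 0)) (sumℚ {suc d} (λ i → u (ρ (suc (toℕ i))))) ((q - 1ℚ) * u (ρ (suc d))))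
  (cong (_+_ (u (ρ 0))) (greedyValue-sum q (ρ ∘ suc) d))

u-next : ∀ {ρ} → Sylvester ρ → u (ρ 1) ≡ u (ρ 0) * size (ρ 0)
u-next {ρ} (pos , step) = trans
  (cong u (trans (step 0) (cong (ρ 0 ℕ.*_) (ℕ.+-comm (ρ 0) 1))))
  (u-product (pos 0))

u-next-gap : ∀ {ρ} → Sylvester ρ → u (ρ 0) ≡ size (ρ 0) + u (ρ 1)
u-next-gap {ρ} ρS@(pos , _) = E.begin
  a               E.≡⟨ u-telescope (pos 0) ⟩
  (1ℚ + a) * b    E.≡⟨ solve 2 (λ a b → (con 1ℚ :+ a) :* b := b :+ a :* b) refl a b ⟩
  b + a * b       E.≡⟨ cong (_+_ b) (u-next ρS) ⟨
  b + u (ρ 1)     E.∎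
  where
  a = u (ρ 0)
  b = size (ρ 0)

module _ {n : ℕ} where

  sizes : Vector ℚ n
  sizes i = size (index i)

  profits : ℚ → Vector ℚ n
  profits q i = profit q (index i)

  0≤sizes : ∀ i → 0ℚ ≤ sizes i
  0≤sizes i = 0≤u (suc (index i))

  -- The packing is chosen before `q`: one packing has the greedy value at all densities, hence at
  -- every term of a Cauchy sequence.
  greedy : ∀ d ρ → Sylvester ρ → (∀ j → j ℕ.< d → ∃ λ (p : Fin n) → index p ≡ ρ j) →
           ∃ λ z → u (ρ 0) ≡ z · sizes + u (ρ d) ×
                   (∀ q → z · profits q + q * u (ρ 0) ≡ greedyValue q ρ d)
  greedy zero ρ _ _ = (λ _ → 0) ,
    sym (trans (cong (_+ u (ρ 0)) (·-zero sizes)) (+-identityˡ (u (ρ 0)))) ,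
    λ q → trans (cong (_+ q * u (ρ 0)) (·-zero (profits q))) (+-identityˡ (q * u (ρ 0)))
  greedy (suc d) ρ ρS item
    with z , used , value ← greedy d (ρ ∘ suc) (tail-Sylvester ρS) (λ j j<d → item (suc j) (s≤s j<d))
       | p , p≡ ← item 0 (s≤s z≤n) = updateAt z p suc , used′ , value′
    where
    a = u (ρ 0)
    b = size (ρ 0)
    c = u (ρ 1)
    s = z · sizes
    t = u (ρ (suc d))
    used′ : a ≡ updateAt z p suc · sizes + t
    used′ = E.begin
      a                E.≡⟨ u-next-gap ρS ⟩
      b + c            E.≡⟨ cong (_+_ b) used ⟩
      b + (s + t)      E.≡⟨ +-assoc b s t ⟨
      (b + s) + t      E.≡⟨ cong (λ j → (size j + s) + t) p≡ ⟨
      (sizes p + s) + t E.≡⟨ cong (_+ t) (·-add z p sizes) ⟨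
      updateAt z p suc · sizes + t E.∎
    value′ : ∀ q → updateAt z p suc · profits q + q * a ≡ a + greedyValue q (ρ ∘ suc) d
    value′ q = E.begin
      updateAt z p suc · profits q + q * a E.≡⟨ cong (_+ q * a) (·-add z p (profits q)) ⟩
      (profit q (index p) + f) + q * a     E.≡⟨ cong (λ j → (profit q j + f) + q * a) p≡ ⟩
      ((a - q * b) + f) + q * a
        -- Splitting the capacity as `b + c` lets the charge `q * b` of the new item cancel.
        E.≡⟨ cong (λ x → ((a - q * b) + f) + q * x) (u-next-gap ρS) ⟩
      ((a - q * b) + f) + q * (b + c)
        E.≡⟨ solve 5 (λ a b c f q → ((a :- q :* b) :+ f) :+ q :* (b :+ c) := a :+ (f :+ q :* c)) refl a b c f q ⟩
      a + (f + q * c)                      E.≡⟨ cong (_+_ a) (value q) ⟩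
      a + greedyValue q (ρ ∘ suc) d        E.∎
      where f = z · profits q

-- The comparison with an empty bin: each greedy item earns at least what its own size would earn at
-- density `q`.
greedyValue-≥ : ∀ {q ρ} d → Sylvester ρ → (∀ j → j ℕ.< d → q * size (ρ j) ≤ u (ρ j)) →
                q * u (ρ 0) ≤ greedyValue q ρ d
greedyValue-≥         zero    _  _       = ≤-refl
greedyValue-≥ {q} {ρ} (suc d) ρS useful = begin
  q * u (ρ 0)               ≡⟨ cong (q *_) (u-next-gap ρS) ⟩
  q * (size (ρ 0) + u (ρ 1)) ≡⟨ *-distribˡ-+ q (size (ρ 0)) (u (ρ 1)) ⟩
  q * size (ρ 0) + q * u (ρ 1)
    ≤⟨ +-mono-≤ (useful 0 (s≤s z≤n)) (greedyValue-≥ d (tail-Sylvester ρS) (λ j j<d → useful (suc j) (s≤s j<d))) ⟩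
  u (ρ 0) + greedyValue q (ρ ∘ suc) d ∎
  where open ≤-Reasoning

-- Optimality of the greedy packing at a rational density.

profit-≤0 : ∀ {q j} → u j ≤ q * size j → profit q j ≤ 0ℚ
profit-≤0 {q} {j} h = subst (profit q j ≤_) (+-inverseʳ (q * size j)) (+-monoˡ-≤ (- (q * size j)) h)

-- An item of kind j > r has density 1 + 1/j ≤ 1 + 1/(r+1).
profit-≤ : ∀ {q r j} → r ℕ.< j → profit q j ≤ ((1ℚ + size r - q) ⊔ 0ℚ) * size j
profit-≤ {q} {r} {j} r<j = begin
  u j - q * size j
    ≡⟨ cong (_- q * size j) (u-telescope (ℕ.≤-trans (s≤s z≤n) r<j)) ⟩
  (1ℚ + u j) * size j - q * size j
    ≡⟨ solve 3 (λ a b q → (con 1ℚ :+ a) :* b :- q :* b := (con 1ℚ :+ a :- q) :* b) refl (u j) (size j) q ⟩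
  (1ℚ + u j - q) * size j
    ≤⟨ *-monoʳ (0≤u (suc j)) (+-monoˡ-≤ (- q) (+-monoʳ-≤ 1ℚ (u-antitone (s≤s z≤n) r<j))) ⟩
  (1ℚ + size r - q) * size j            ≤⟨ *-monoʳ (0≤u (suc j)) (p≤p⊔q (1ℚ + size r - q) 0ℚ) ⟩
  ((1ℚ + size r - q) ⊔ 0ℚ) * size j     ∎
  where open ≤-Reasoning

module _ {q : ℚ} (1≤q : 1ℚ ≤ q) where

  module _ {n d ρ} (ρS : Sylvester ρ)
           (useful : ∀ j → j ℕ.< suc d → q * size (ρ j) ≤ u (ρ j))
           (z : Vector ℕ n) (fits : z · sizes < u (ρ 0)) where
    open ≤-Reasoning
    private
      a = u (ρ 0)
      b = size (ρ 0)
      -- The excess over `q` of the best density among kinds above `ρ 0`. Truncation at 0 allows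
      -- multiplying `fits` by it.
      κ = (1ℚ + b - q) ⊔ 0ℚ
      V = greedyValue q (ρ ∘ suc) d
      useful′ : ∀ j → j ℕ.< d → q * size (ρ (suc j)) ≤ u (ρ (suc j))
      useful′ j j<d = useful (suc j) (s≤s j<d)

    -- All items have kind > ρ 0, so a bin of capacity a is worth at most a
    -- times the larger of q and 1 + 1/(ρ(0) + 1).
    bound-without : ∀ {p} → index p ≡ ρ 0 → z p ≡ 0 →
                    z · profits q + q * a ≤ greedyValue q ρ (suc d)
    bound-without {p} p≡ zp≡0 = begin
      z · profits q + q * a            ≤⟨ +-monoˡ-≤ (q * a) (sumℚ-mono term) ⟩
      z · (λ i → κ * sizes i) + q * a  ≡⟨ cong (_+ q * a) (·-scale z κ sizes) ⟩
      κ * z · sizes + q * a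
        ≤⟨ +-monoˡ-≤ (q * a) (*-monoˡ (p≤q⊔p (1ℚ + b - q) 0ℚ) (<⇒≤ fits)) ⟩
      κ * a + q * a                    ≤⟨ dense ⟩
      a + V                            ∎
      where
      -- A kind below `ρ 0` has size at least `a`, which the strict capacity constraint forbids;
      -- kind `ρ 0` itself is absent by `zp≡0`.
      none : ∀ i → index i ℕ.≤ ρ 0 → z i ≡ 0
      none i i≤ with index i ℕ.≟ ρ 0
      ... | yes i≡ = subst (λ i → z i ≡ 0) (toℕ-injective (ℕ.suc-injective (trans p≡ (sym i≡)))) zp≡0
      ... | no  i≢ = ·-<⇒≡0 z 0≤sizes fits i (u-antitone (s≤s z≤n) (ℕ.≤∧≢⇒< i≤ i≢))
      term : ∀ i → ι (z i) * profits q i ≤ ι (z i) * (κ * sizes i)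
      term i with index i ℕ.≤? ρ 0
      ... | no  i≰ = *-monoˡ (0≤ι (z i)) (profit-≤ (ℕ.≰⇒> i≰))
      ... | yes i≤ rewrite none i i≤ | ι0≡0 =
        ≤-reflexive (trans (*-zeroˡ (profits q i)) (sym (*-zeroˡ (κ * sizes i))))
      -- If κ is the excess, the left side is a + ab with ab = 1/ρ(1), and 1 ≤ q makes the rest of
      -- the greedy packing worth at least ab. If κ = 0, the left side is the value of an empty bin.
      dense : κ * a + q * a ≤ a + V
      dense with ⊔-sel (1ℚ + b - q) 0ℚ
      ... | inj₁ eq = begin
        κ * a + q * a             ≡⟨ cong (λ x → x * a + q * a) eq ⟩
        (1ℚ + b - q) * a + q * a
          ≡⟨ solve 3 (λ a b q → (con 1ℚ :+ b :- q) :* a :+ q :* a := a :+ con 1ℚ :* (a :* b)) refl a b q ⟩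
        a + 1ℚ * (a * b)          ≡⟨ cong (λ x → a + 1ℚ * x) (u-next ρS) ⟨
        a + 1ℚ * u (ρ 1)          ≤⟨ +-monoʳ-≤ a (*-monoʳ (0≤u (ρ 1)) 1≤q) ⟩
        a + q * u (ρ 1)           ≤⟨ +-monoʳ-≤ a (greedyValue-≥ d (tail-Sylvester ρS) useful′) ⟩
        a + V                     ∎
      ... | inj₂ eq = begin
        κ * a + q * a             ≡⟨ cong (λ x → x * a + q * a) eq ⟩
        0ℚ * a + q * a            ≡⟨ trans (cong (_+ q * a) (*-zeroˡ a)) (+-identityˡ (q * a)) ⟩
        q * a                     ≤⟨ greedyValue-≥ (suc d) ρS useful ⟩
        a + V                     ∎

  -- Induction on `d`. A copy of kind `ρ 0`, if present, is removed, which leaves a bin of capacity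
  -- 1/ρ(1); otherwise `bound-without` applies. For `d` = 0, kinds below `ρ 0` do not fit and the
  -- others have no positive profit.
  greedyValue-optimal : ∀ {n} d ρ → Sylvester ρ →
    (∀ j → j ℕ.< d → ∃ λ (p : Fin n) → index p ≡ ρ j) →
    (∀ j → j ℕ.< d → q * size (ρ j) ≤ u (ρ j)) →
    (∀ (i : Fin n) → ρ d ℕ.≤ index i → u (index i) ≤ q * sizes i) →
    ∀ (z : Vector ℕ n) → z · sizes < u (ρ 0) → z · profits q + q * u (ρ 0) ≤ greedyValue q ρ d
  greedyValue-optimal zero ρ ρS _ _ useless z fits = begin
    z · profits q + q * u (ρ 0)      ≤⟨ +-monoˡ-≤ (q * u (ρ 0)) (sumℚ-mono term) ⟩
    z · (λ _ → 0ℚ) + q * u (ρ 0)     ≡⟨ cong (_+ q * u (ρ 0)) zeros ⟩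
    0ℚ + q * u (ρ 0)                 ≡⟨ +-identityˡ (q * u (ρ 0)) ⟩
    q * u (ρ 0)                      ∎
    where
    open ≤-Reasoning
    zeros : z · (λ _ → 0ℚ) ≡ 0ℚ
    zeros = trans (·-scale z 0ℚ (λ _ → 0ℚ)) (*-zeroˡ (z · (λ _ → 0ℚ)))
    term : ∀ i → ι (z i) * profits q i ≤ ι (z i) * 0ℚ
    term i with ρ 0 ℕ.≤? index i
    ... | yes ≤i = *-monoˡ (0≤ι (z i)) (profit-≤0 {q} {index i} (useless i ≤i))
    ... | no  ≰i rewrite ·-<⇒≡0 z 0≤sizes fits i (u-antitone (s≤s z≤n) (ℕ.≰⇒> ≰i)) | ι0≡0 =
      ≤-reflexive (trans (*-zeroˡ (profits q i)) (sym (*-zeroˡ 0ℚ)))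
  greedyValue-optimal {n} (suc d) ρ ρS item useful useless z fits
    with p , p≡ ← item 0 (s≤s z≤n) with z p in zp≡
  ... | zero  = bound-without {d = d} ρS useful z fits p≡ zp≡
  ... | suc m = begin
    z · profits q + q * a
      ≡⟨ cong₂ (λ x y → x + q * y) (·-remove z p (profits q) zp≡) (u-next-gap ρS) ⟩
    (profits q p + f) + q * (b + c)         ≡⟨ cong (λ j → (profit q j + f) + q * (b + c)) p≡ ⟩
    ((a - q * b) + f) + q * (b + c)
      ≡⟨ solve 5 (λ a b c f q → ((a :- q :* b) :+ f) :+ q :* (b :+ c) := a :+ (f :+ q :* c)) refl a b c f q ⟩
    a + (f + q * c)
      ≤⟨ +-monoʳ-≤ a (greedyValue-optimal d (ρ ∘ suc) (tail-Sylvester ρS)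
           (λ j j<d → item (suc j) (s≤s j<d))
           (λ j j<d → useful (suc j) (s≤s j<d)) useless z′ fits′) ⟩
    a + greedyValue q (ρ ∘ suc) d           ∎
    where
    open ≤-Reasoning
    a = u (ρ 0)
    b = size (ρ 0)
    c = u (ρ 1)
    z′ : Vector ℕ n
    z′ = updateAt z p ℕ.pred
    f = z′ · profits q
    fits′ : z′ · sizes < c
    fits′ = begin-strict
      z′ · sizes                       ≡⟨ solve 2 (λ x y → x := (y :+ x) :- y) refl (z′ · sizes) b ⟩
      (b + z′ · sizes) - b             ≡⟨ cong (λ j → (size j + z′ · sizes) - b) p≡ ⟨
      (sizes p + z′ · sizes) - b       ≡⟨ cong (_- b) (·-remove z p sizes zp≡) ⟨
      z · sizes - b                    <⟨ +-monoˡ-< (- b) fits ⟩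
      a - b                            ≡⟨ cong (_- b) (u-next-gap ρS) ⟩
      (b + c) - b                      ≡⟨ solve 2 (λ b c → (b :+ c) :- b := c) refl b c ⟩
      c                                ∎

-- Rational estimates for the threshold.

p≤∣p∣ : ∀ p → p ≤ ∣ p ∣
p≤∣p∣ p with ≤-total 0ℚ p
... | inj₁ 0≤p = ≤-reflexive (sym (0≤p⇒∣p∣≡p 0≤p))
... | inj₂ p≤0 = ≤-trans p≤0 (0≤∣p∣ p)

∣-∣≤⇒≤ : ∀ {p q ε} → ∣ p - q ∣ ≤ ε → p ≤ q + ε
∣-∣≤⇒≤ {p} {q} {ε} h = begin
  p            ≡⟨ solve 2 (λ p q → p := q :+ (p :- q)) refl p q ⟩
  q + (p - q)  ≤⟨ +-monoʳ-≤ q (≤-trans (p≤∣p∣ (p - q)) h) ⟩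
  q + ε        ∎
  where open ≤-Reasoning

p≤p+ε : ∀ {p ε} → 0ℚ ≤ ε → p ≤ p + ε
p≤p+ε {p} {ε} 0≤ε = ≤-trans (p≤r+p 0≤ε) (≤-reflexive (+-comm ε p))

0<½* : ∀ {ε} → 0ℚ < ε → 0ℚ < ½ * ε
0<½* {ε} 0<ε = subst (_< ½ * ε) (*-zeroʳ ½) (*-monoʳ-<-pos ½ 0<ε)

½*+½* : ∀ ε → ½ * ε + ½ * ε ≡ ε
½*+½* ε = trans (sym (*-distribʳ-+ ε ½ ½)) (*-identityˡ ε)

u≤1 : ∀ {n} → 1 ℕ.≤ n → u n ≤ 1ℚ
u≤1 {n} 1≤n = subst (u n ≤_) u1≡1 (u-antitone (s≤s z≤n) 1≤n)

ι*u′ : ∀ {n} → 1 ℕ.≤ n → ι n * u n ≡ 1ℚ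
ι*u′ {suc n} _ = ι*u n

inv-≤ : ∀ {n p} → 1 ℕ.≤ n → u n ≤ p → inv p ≤ ι n
inv-≤ {n} {p} 1≤n u≤p = begin
  inv p                  ≡⟨ *-identityʳ (inv p) ⟨
  inv p * 1ℚ             ≡⟨ cong (inv p *_) (ι*u′ 1≤n) ⟨
  inv p * (ι n * u n)    ≤⟨ *-monoˡ (<⇒≤ (inv-pos 0<p)) (*-monoˡ (0≤ι n) u≤p) ⟩
  inv p * (ι n * p)
    ≡⟨ solve 3 (λ i x p → i :* (x :* p) := (p :* i) :* x) refl (inv p) (ι n) p ⟩
  (p * inv p) * ι n      ≡⟨ cong (_* ι n) (*-inv 0<p) ⟩
  1ℚ * ι n               ≡⟨ *-identityˡ (ι n) ⟩
  ι n                    ∎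
  where
  open ≤-Reasoning
  0<p = <-≤-trans (0<u 1≤n) u≤p

-- Since n + ε < n + 1 ≤ k. It rules out that the maximum in the threshold is 1/k when the ceiling
-- is below k.
u-gap : ∀ {k n ε} → n ℕ.< k → ε < 1ℚ → u k * (ι n + ε) < 1ℚ
u-gap {k} {n} {ε} n<k ε<1 = begin-strict
  u k * (ι n + ε)
    <⟨ *-monoʳ-<-pos (u k) {{positive (0<u (ℕ.≤-trans (s≤s z≤n) n<k))}} (+-monoʳ-< (ι n) ε<1) ⟩
  u k * (ι n + 1ℚ)       ≡⟨ cong (u k *_) (trans (+-comm (ι n) 1ℚ) (sym (ι-suc n))) ⟩
  u k * ι (suc n)        ≤⟨ *-monoʳ (0≤ι (suc n)) (u-antitone (s≤s z≤n) n<k) ⟩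
  u (suc n) * ι (suc n)  ≡⟨ trans (*-comm (u (suc n)) (ι (suc n))) (ι*u n) ⟩
  1ℚ                     ∎
  where open ≤-Reasoning

-- Multiplying the hypothesis by 1/n gives 1/n ≤ p + (p/n)ε, and p/n ≤ 1 in the only case of
-- interest, p ≤ 1/n.
u-approx : ∀ {n p ε} → 1 ℕ.≤ n → 0ℚ ≤ p → 0ℚ ≤ ε → 1ℚ ≤ p * (ι n + ε) → u n ≤ p + ε
u-approx {n} {p} {ε} 1≤n 0≤p 0≤ε h with ≤-total (u n) p
... | inj₁ u≤p = ≤-trans u≤p (p≤p+ε 0≤ε)
... | inj₂ p≤u = begin
  a                          ≡⟨ *-identityʳ a ⟨
  a * 1ℚ                     ≤⟨ *-monoˡ (0≤u n) h ⟩
  a * (p * (ι n + ε))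
    ≡⟨ solve 4 (λ a p x e → a :* (p :* (x :+ e)) := p :* (x :* a) :+ (a :* p) :* e) refl a p (ι n) ε ⟩
  p * (ι n * a) + (a * p) * ε
    ≤⟨ +-mono-≤ (≤-reflexive (trans (cong (p *_) (ι*u′ 1≤n)) (*-identityʳ p))) (*-monoʳ 0≤ε ap≤1) ⟩
  p + 1ℚ * ε                 ≡⟨ cong (_+_ p) (*-identityˡ ε) ⟩
  p + ε                      ∎
  where
  open ≤-Reasoning
  a = u n
  ap≤1 : a * p ≤ 1ℚ
  ap≤1 = begin
    a * p   ≤⟨ *-monoʳ 0≤p (u≤1 1≤n) ⟩
    1ℚ * p  ≡⟨ *-identityˡ p ⟩
    p       ≤⟨ p≤u ⟩
    a       ≤⟨ u≤1 1≤n ⟩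
    1ℚ      ∎

-- By `u-gap` the maximum cannot be 1/k, so it is p - 1, to which `u-approx` applies.
threshold-≥ : ∀ {p k c ε} → 1 ℕ.≤ c → c ℕ.< k → 0ℚ ≤ ε → ε < 1ℚ →
              inv ((p - 1ℚ) ⊔ u k) ≤ ι c + ε → 1ℚ + u c ≤ p + ε
threshold-≥ {p} {k} {c} {ε} 1≤c c<k 0≤ε ε<1 inv≤ = split (⊔-sel (p - 1ℚ) (u k))
  where
  open ≤-Reasoning
  t = (p - 1ℚ) ⊔ u k
  0<t : 0ℚ < t
  0<t = <-≤-trans (0<u (ℕ.≤-trans (s≤s z≤n) c<k)) (p≤q⊔p (p - 1ℚ) (u k))
  1≤ : 1ℚ ≤ t * (ι c + ε)
  1≤ = subst (_≤ t * (ι c + ε)) (*-inv 0<t) (*-monoˡ (<⇒≤ 0<t) inv≤)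
  split : t ≡ p - 1ℚ ⊎ t ≡ u k → 1ℚ + u c ≤ p + ε
  split (inj₁ eq) = begin
    1ℚ + u c
      ≤⟨ +-monoʳ-≤ 1ℚ (u-approx 1≤c (subst (0ℚ ≤_) eq (<⇒≤ 0<t)) 0≤ε (subst (λ x → 1ℚ ≤ x * (ι c + ε)) eq 1≤)) ⟩
    1ℚ + ((p - 1ℚ) + ε)  ≡⟨ solve 2 (λ p e → con 1ℚ :+ ((p :- con 1ℚ) :+ e) := p :+ e) refl p ε ⟩
    p + ε                ∎
  split (inj₂ eq) = contradiction
    (≤-<-trans (subst (λ x → 1ℚ ≤ x * (ι c + ε)) eq 1≤) (u-gap c<k ε<1)) (<-irrefl refl)

-- `q` is the projection of `p` onto the interval. It is needed because terms of a Cauchy sequence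
-- may lie slightly outside the bounds that hold for its limit.
clamp : ∀ {lo hi p ε} → lo ≤ hi → 0ℚ ≤ ε → lo ≤ p + ε → p ≤ hi + ε →
        ∃ λ q → (lo ≤ q × q ≤ hi) × (p ≤ q + ε × q ≤ p + ε)
clamp {lo} {hi} {p} lo≤hi 0≤ε lo≤ ≤hi with ≤-total p lo
... | inj₁ p≤lo = lo , (≤-refl , lo≤hi) , ≤-trans p≤lo (p≤p+ε 0≤ε) , lo≤
... | inj₂ lo≤p with ≤-total p hi
...   | inj₁ p≤hi = p , (lo≤p , p≤hi) , p≤p+ε 0≤ε , p≤p+ε 0≤ε
...   | inj₂ hi≤p = hi , (lo≤hi , ≤-refl) , ≤hi , ≤-trans hi≤p (p≤p+ε 0≤ε)

-- Lipschitz dependence on the density.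

packingValue : ∀ {n} → ℚ → Vector ℕ n → ℚ
packingValue q z = z · profits q + q * u 1

-- The value is affine in the density; its slope is the free capacity, which lies between 0 and 1.
packingValue-lipschitz : ∀ {n p q ε} (z : Vector ℕ n) → z · sizes < u 1 → 0ℚ ≤ ε → p ≤ q + ε →
                         packingValue p z ≤ packingValue q z + ε
packingValue-lipschitz {n} {p} {q} {ε} z fits 0≤ε p≤q+ε = begin
  z · profits p + p * u 1            ≡⟨ affine p ⟩
  w + p * free                       ≤⟨ +-monoʳ-≤ w (*-monoʳ 0≤free p≤q+ε) ⟩
  w + (q + ε) * free
    ≡⟨ solve 4 (λ w q e f → w :+ (q :+ e) :* f := (w :+ q :* f) :+ e :* f) refl w q ε free ⟩
  (w + q * free) + ε * free
    ≤⟨ +-mono-≤ (≤-reflexive (sym (affine q))) (*-monoˡ 0≤ε free≤1) ⟩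
  packingValue q z + ε * 1ℚ          ≡⟨ cong (_+_ (packingValue q z)) (*-identityʳ ε) ⟩
  packingValue q z + ε               ∎
  where
  open ≤-Reasoning
  w = z · (u ∘ index)
  s = z · sizes
  free = u 1 - s
  affine : ∀ q → packingValue q z ≡ w + q * free
  affine q = trans (cong (_+ q * u 1) (·-affine z (u ∘ index) q sizes))
    (solve 4 (λ w q s o → (w :- q :* s) :+ q :* o := w :+ q :* (o :- s)) refl w q s (u 1))
  0≤free : 0ℚ ≤ free
  0≤free = subst (_≤ free) (+-inverseʳ s) (+-monoˡ-≤ (- s) (<⇒≤ fits))
  free≤1 : free ≤ 1ℚ
  free≤1 = begin
    u 1 - s         ≤⟨ p≤p+ε (·-nonNeg z 0≤sizes) ⟩
    (u 1 - s) + s   ≡⟨ solve 2 (λ o s → (o :- s) :+ s := o) refl (u 1) s ⟩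
    u 1             ≡⟨ u1≡1 ⟩
    1ℚ              ∎

-- The slope in the density is 1/ρ(d) ≤ 1.
greedyValue-lipschitz : ∀ {p q ε ρ} d → Sylvester ρ → 0ℚ ≤ ε → p ≤ q + ε →
                        greedyValue p ρ d ≤ greedyValue q ρ d + ε
greedyValue-lipschitz {p} {q} {ε} {ρ} zero (pos , _) 0≤ε p≤q+ε = begin
  p * a          ≤⟨ *-monoʳ (0≤u (ρ 0)) p≤q+ε ⟩
  (q + ε) * a    ≡⟨ *-distribʳ-+ a q ε ⟩
  q * a + ε * a  ≤⟨ +-monoʳ-≤ (q * a) (*-monoˡ 0≤ε (u≤1 (pos 0))) ⟩
  q * a + ε * 1ℚ ≡⟨ cong (_+_ (q * a)) (*-identityʳ ε) ⟩
  q * a + ε      ∎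
  where
  open ≤-Reasoning
  a = u (ρ 0)
greedyValue-lipschitz {p} {q} {ε} {ρ} (suc d) ρS 0≤ε p≤q+ε = ≤-trans
  (+-monoʳ-≤ (u (ρ 0)) (greedyValue-lipschitz d (tail-Sylvester ρS) 0≤ε p≤q+ε))
  (≤-reflexive (sym (+-assoc (u (ρ 0)) (greedyValue q (ρ ∘ suc) d) ε)))

-- Termwise evaluation of the real expressions.

seq-sumᴿ : ∀ {m} (v : Vector ℝ m) n → seq (sumᴿ v) n ≡ sumℚ (λ i → seq (v i) n)
seq-sumᴿ {zero}  v n = refl
seq-sumᴿ {suc m} v n = cong (_+_ (seq (v zero) n)) (seq-sumᴿ (v ∘ suc) n)

-- Real operations act termwise, so the rational objective appears exactly, without an error term.
-- The factor `u 1` is the capacity 1/ρ(0) of the full bin.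
seq-objective : ∀ k μ z n → seq (objective k μ z) n ≡ packingValue (seq μ n) z
seq-objective k μ z n = E.begin
  seq (objective k μ z) n    E.≡⟨ cong (_+_ m) (trans (seq-sumᴿ terms n) (sumℚ-cong term)) ⟩
  m + z · profits m          E.≡⟨ +-comm m (z · profits m) ⟩
  z · profits m + m
    E.≡⟨ cong (_+_ (z · profits m)) (trans (cong (m *_) u1≡1) (*-identityʳ m)) ⟨
  z · profits m + m * u 1    E.∎
  where
  m = seq μ n
  terms : Vector ℝ (k ℕ.∸ 1)
  terms i = fromℕ (z i) *ᴿ (1/ᴿ index i -ᴿ μ *ᴿ (1/ᴿ suc (index i)))
  term : ∀ i → seq (terms i) n ≡ ι (z i) * profits m i
  term i = cong₂ _*_ (sym (ι≡/1 (z i)))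
    (cong₂ (λ x y → x - m * y) (1/≡u (index i)) (1/≡u (suc (index i))))

pointwise-≃ᴿ : ∀ {x y} → (∀ n → seq x n ≡ seq y n) → x ≃ᴿ y
pointwise-≃ᴿ {x} {y} x≡y ε 0<ε = 0 , λ n _ → begin
  ∣ seq x n - seq y n ∣  ≡⟨ cong (λ p → ∣ p - seq y n ∣) (x≡y n) ⟩
  ∣ seq y n - seq y n ∣  ≡⟨ cong ∣_∣ (+-inverseʳ (seq y n)) ⟩
  0ℚ                     ≤⟨ <⇒≤ 0<ε ⟩
  ε                      ∎
  where open ≤-Reasoning

r-pos : ∀ j → 1 ℕ.≤ r j
r-pos j = ℕ.>-nonZero⁻¹ (r j) {{r-nonZero j}}

-- The shift drops the placeholder `r 0`, at which the recursion fails.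
r-Sylvester : Sylvester (r ∘ suc)
r-Sylvester = r-pos ∘ suc , λ _ → refl

r-mono : ∀ {i j} → 1 ℕ.≤ i → i ℕ.≤ j → r i ℕ.≤ r j
r-mono {i} 1≤i = go ∘ ℕ.≤⇒≤′
  where
  go : ∀ {j} → i ℕ.≤′ j → r i ℕ.≤ r j
  go ℕ.≤′-refl = ℕ.≤-refl
  go {suc zero}    (ℕ.≤′-step i≤j) = contradiction (ℕ.≤-trans 1≤i (ℕ.≤′⇒≤ i≤j)) λ ()
  go {suc (suc j)} (ℕ.≤′-step i≤j) = ℕ.≤-trans (go i≤j)
    (ℕ.m≤m*n (r (suc j)) (r (suc j) ℕ.+ 1) {{ℕ.>-nonZero (ℕ.m≤n+m 1 (r (suc j)))}})

seq-closedForm : ∀ μ Q n → seq (closedForm μ Q) n ≡ greedyValue (seq μ n) (r ∘ suc) Q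
seq-closedForm μ Q n = trans
  (cong₂ (λ x y → x + (seq μ n - 1ℚ) * y)
    (trans (seq-sumᴿ {suc Q} (1/r ∘ index) n) (sumℚ-cong {suc Q} (λ i → 1/≡u (r (index i)) {{r-nonZero (index i)}})))
    (1/≡u (r (suc Q)) {{r-nonZero (suc Q)}}))
  (greedyValue-sum (seq μ n) (r ∘ suc) Q)

size-sum : ∀ {n} (z : Vector ℕ n) → sumℚ (λ i → + z i / suc (index i)) ≡ z · sizes
size-sum z = sumℚ-cong (λ i → /≡ι*u (z i) (index i))

Feasible⇒ : ∀ k {z} → Feasible k z → z · sizes < u 1
Feasible⇒ k {z} = subst₂ _<_ (size-sum z) (sym u1≡1)

⇒Feasible : ∀ k {z} → z · sizes < u 1 → Feasible k z
⇒Feasible k {z} = subst₂ _<_ (sym (size-sum z)) u1≡1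

-- Bounds on μ drawn from the ceiling.

module _ (μ : ℝ) (k : ℕ) .{{k≢0 : NonZero k}} where

  private
    t : ℕ → ℚ
    t = seq (threshold μ k)
    1≤k : 1 ℕ.≤ k
    1≤k = ℕ.>-nonZero⁻¹ k

  -- The threshold is at least 1/k. Hence the ceiling is at most `k`, and the greedy kinds are among
  -- 1, ..., k-1.
  recip-threshold-≤k : recip (threshold μ k) (threshold-pos μ k) ≤ᴿ fromℕ k
  recip-threshold-≤k ε 0<ε = 0 , λ n _ → ≤-trans
    (inv-≤ {k} {t n} 1≤k (subst (_≤ t n) (1/≡u k) (p≤q⊔p (seq μ n - 1ℚ) (+ 1 / k))))
    (subst (_≤ + k / 1 + ε) (sym (ι≡/1 k)) (p≤p+ε (<⇒≤ 0<ε)))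

  1+u≤μ : ∀ {c} → 1 ℕ.≤ c → c ℕ.< k →
          recip (threshold μ k) (threshold-pos μ k) ≤ᴿ fromℕ c →
          fromℚ (1ℚ + u c) ≤ᴿ μ
  1+u≤μ {c} 1≤c c<k recip≤c ε 0<ε = proj₁ near , λ n N≤n → ≤-trans
    (threshold-≥ {seq μ n} 1≤c c<k (<⇒≤ 0<δ) (≤-<-trans (p⊓q≤q ε ½) (from-yes (½ <? 1ℚ)))
      (subst₂ (λ x y → inv ((seq μ n - 1ℚ) ⊔ x) ≤ y + δ) (1/≡u k) (sym (ι≡/1 c)) (proj₂ near n N≤n)))
    (+-monoʳ-≤ (seq μ n) (p⊓q≤p ε ½))
    where
    -- `threshold-≥` needs a tolerance below 1.
    δ = ε ⊓ ½
    0<δ : 0ℚ < δ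
    0<δ with ⊓-sel ε ½
    ... | inj₁ eq = subst (0ℚ <_) (sym eq) 0<ε
    ... | inj₂ eq = subst (0ℚ <_) (sym eq) (positive⁻¹ ½)
    near = recip≤c δ 0<δ

  -- Otherwise μ would stay above 1 + 1/m from some index on, which makes the
  -- reciprocal at most m.
  μ≤1+u : ∀ {m} → 1 ℕ.≤ m →
          ¬ recip (threshold μ k) (threshold-pos μ k) ≤ᴿ fromℕ m →
          μ ≤ᴿ fromℚ (1ℚ + u m)
  μ≤1+u {m} 1≤m recip≰m ε 0<ε with cauchy μ (½ * ε) (0<½* 0<ε)
  -- A decidable test at one rational term; the Cauchy property carries the answer to all later
  -- terms at the cost of the other half of `ε`.
  ... | N , near with seq μ N ≤? (1ℚ + u m) + ½ * ε
  ...   | yes μN≤ = N , λ n N≤n → begin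
    seq μ n                            ≤⟨ ∣-∣≤⇒≤ (near n N N≤n ℕ.≤-refl) ⟩
    seq μ N + ½ * ε                    ≤⟨ +-monoˡ-≤ (½ * ε) μN≤ ⟩
    ((1ℚ + u m) + ½ * ε) + ½ * ε       ≡⟨ +-assoc (1ℚ + u m) (½ * ε) (½ * ε) ⟩
    (1ℚ + u m) + (½ * ε + ½ * ε)       ≡⟨ cong (_+_ (1ℚ + u m)) (½*+½* ε) ⟩
    (1ℚ + u m) + ε                     ∎
    where open ≤-Reasoning
  ...   | no μN≰ = contradiction recip≤m recip≰m
    where
    open ≤-Reasoning
    u≤ : ∀ n → N ℕ.≤ n → u m ≤ t n
    u≤ n N≤n = begin
      u m
        ≡⟨ solve 2 (λ a e → a := (((con 1ℚ :+ a) :+ e) :- e) :- con 1ℚ) refl (u m) (½ * ε) ⟩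
      (((1ℚ + u m) + ½ * ε) - ½ * ε) - 1ℚ
        ≤⟨ +-monoˡ-≤ (- 1ℚ) (+-monoˡ-≤ (- (½ * ε)) (≤-trans (<⇒≤ (≰⇒> μN≰)) (∣-∣≤⇒≤ (near N n ℕ.≤-refl N≤n)))) ⟩
      ((seq μ n + ½ * ε) - ½ * ε) - 1ℚ
        ≡⟨ solve 2 (λ a e → ((a :+ e) :- e) :- con 1ℚ := a :- con 1ℚ) refl (seq μ n) (½ * ε) ⟩
      seq μ n - 1ℚ                             ≤⟨ p≤p⊔q (seq μ n - 1ℚ) (+ 1 / k) ⟩
      t n                                      ∎
    recip≤m : recip (threshold μ k) (threshold-pos μ k) ≤ᴿ fromℕ m
    recip≤m δ 0<δ = N , λ n N≤n → ≤-trans (inv-≤ 1≤m (u≤ n N≤n))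
      (subst (_≤ + m / 1 + δ) (sym (ι≡/1 m)) (p≤p+ε (<⇒≤ 0<δ)))

-- Attainment and maximality for a real density.

module _ (k Q : ℕ) (μ : ℝ) (rQ<k : r Q ℕ.< k) where

  private
    ρ = r ∘ suc

    ρ≤rQ : ∀ {j} → j ℕ.< Q → ρ j ℕ.≤ r Q
    ρ≤rQ = r-mono (s≤s z≤n)

    item : ∀ j → j ℕ.< Q → ∃ λ (p : Fin (k ℕ.∸ 1)) → index p ≡ ρ j
    -- `index` adds one, so kind `ρ j` sits at position `ρ j` - 1.
    item j j<Q = fromℕ< bound , trans (cong suc (toℕ-fromℕ< bound)) (ℕ.suc-pred (ρ j) {{r-nonZero (suc j)}})
      where
      bound : ℕ.pred (ρ j) ℕ.< k ℕ.∸ 1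
      bound = ℕ.≤-trans (ℕ.≤-reflexive (ℕ.suc-pred (ρ j) {{r-nonZero (suc j)}}))
        (ℕ.≤-trans (ρ≤rQ j<Q) (ℕ.pred-mono-≤ rQ<k))

  greedy-packing : ∃ λ z → z · sizes {k ℕ.∸ 1} < u 1 ×
                           (∀ q → packingValue q z ≡ greedyValue q ρ Q)
  greedy-packing with z , used , value ← greedy Q ρ r-Sylvester item = z , fits , value
    where
    open ≤-Reasoning
    fits : z · sizes < u 1
    fits = begin-strict
      z · sizes               ≡⟨ +-identityʳ (z · sizes) ⟨
      z · sizes + 0ℚ          <⟨ +-monoʳ-< (z · sizes) (0<u (r-pos (suc Q))) ⟩
      z · sizes + u (ρ Q)     ≡⟨ used ⟨
      u 1                     ∎

  closedForm-attained : ∃ λ z → Feasible k z × objective k μ z ≃ᴿ closedForm μ Q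
  closedForm-attained =
    let z , fits , value = greedy-packing
    in z , ⇒Feasible k {z} fits , pointwise-≃ᴿ {objective k μ z} {closedForm μ Q} λ n →
      trans (seq-objective k μ z n) (trans (value (seq μ n)) (sym (seq-closedForm μ Q n)))

  -- `ℓ` bounds μ - 1 from below and 1/i from above for every kind i ≥ r(Q+1), so these kinds have
  -- density at most 1 + `ℓ` and bring no profit. The upper bound on μ makes the greedy kinds worth
  -- taking.
  closedForm-maximal : ∀ {ℓ} → 0ℚ ≤ ℓ → ℓ ≤ u (r Q) →
    (∀ (i : Fin (k ℕ.∸ 1)) → ρ Q ℕ.≤ index i → u (index i) ≤ ℓ) →
    fromℚ (1ℚ + ℓ) ≤ᴿ μ → μ ≤ᴿ fromℚ (1ℚ + u (r Q)) →
    ∀ z → Feasible k z → objective k μ z ≤ᴿ closedForm μ Q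
  closedForm-maximal {ℓ} 0≤ℓ ℓ≤u small lo≤μ μ≤hi z feasible ε 0<ε =
    let N₁ , lo≤ = lo≤μ (½ * ε) (0<½* 0<ε)
        N₂ , ≤hi = μ≤hi (½ * ε) (0<½* 0<ε)
    in N₁ ℕ.⊔ N₂ , λ n N≤n → begin
      seq (objective k μ z) n      ≡⟨ seq-objective k μ z n ⟩
      packingValue (seq μ n) z
        ≤⟨ bound (seq μ n) (lo≤ n (ℕ.m⊔n≤o⇒m≤o N₁ N₂ N≤n)) (≤hi n (ℕ.m⊔n≤o⇒n≤o N₁ N₂ N≤n)) ⟩
      greedyValue (seq μ n) ρ Q + ε ≡⟨ cong (_+ ε) (seq-closedForm μ Q n) ⟨
      seq (closedForm μ Q) n + ε   ∎
    where
    open ≤-Reasoning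
    δ = ½ * ε
    0≤δ = <⇒≤ (0<½* 0<ε)
    fits = Feasible⇒ k {z} feasible

    optimal : ∀ {q} → 1ℚ + ℓ ≤ q → q ≤ 1ℚ + u (r Q) → packingValue q z ≤ greedyValue q ρ Q
    optimal {q} lo≤q q≤hi = greedyValue-optimal
      (≤-trans (p≤p+ε 0≤ℓ) lo≤q) Q ρ r-Sylvester item useful useless z fits
      where
      useful : ∀ j → j ℕ.< Q → q * size (ρ j) ≤ u (ρ j)
      useful j j<Q = begin
        q * size (ρ j)
          ≤⟨ *-monoʳ (0≤u (suc (ρ j))) (≤-trans q≤hi (+-monoʳ-≤ 1ℚ (u-antitone (r-pos (suc j)) (ρ≤rQ j<Q)))) ⟩
        (1ℚ + u (ρ j)) * size (ρ j)  ≡⟨ u-telescope (r-pos (suc j)) ⟨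
        u (ρ j)                      ∎
      useless : ∀ i → ρ Q ℕ.≤ index i → u (index i) ≤ q * sizes i
      useless i ρQ≤i = begin
        u (index i)                  ≡⟨ u-telescope (s≤s z≤n) ⟩
        (1ℚ + u (index i)) * sizes i
          ≤⟨ *-monoʳ (0≤sizes i) (≤-trans (+-monoʳ-≤ 1ℚ (small i ρQ≤i)) lo≤q) ⟩
        q * sizes i                  ∎

    bound : ∀ p → 1ℚ + ℓ ≤ p + δ → p ≤ (1ℚ + u (r Q)) + δ →
            packingValue p z ≤ greedyValue p ρ Q + ε
    bound p lo≤p p≤hi with clamp (+-monoʳ-≤ 1ℚ ℓ≤u) 0≤δ lo≤p p≤hi
    -- Moving from `p` to `q` costs `δ`, and so does moving back.
    ... | q , (lo≤q , q≤hi) , p≤q+δ , q≤p+δ = begin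
      packingValue p z                 ≤⟨ packingValue-lipschitz {q = q} z fits 0≤δ p≤q+δ ⟩
      packingValue q z + δ             ≤⟨ +-monoˡ-≤ δ (optimal {q} lo≤q q≤hi) ⟩
      greedyValue q ρ Q + δ
        ≤⟨ +-monoˡ-≤ δ (greedyValue-lipschitz {q} Q r-Sylvester 0≤δ q≤p+δ) ⟩
      (greedyValue p ρ Q + δ) + δ      ≡⟨ +-assoc (greedyValue p ρ Q) δ δ ⟩
      greedyValue p ρ Q + (δ + δ)      ≡⟨ cong (_+_ (greedyValue p ρ Q)) (½*+½* ε) ⟩
      greedyValue p ρ Q + ε            ∎

theorem2 : (k : ℕ) .{{_ : NonZero k}} → 2 ℕ.≤ k →
    (μ : ℝ) → 1ᴿ ≤ᴿ μ → μ <ᴿ fromℕ 2 →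
    (c : ℤ) → IsCeiling (recip (threshold μ k) (threshold-pos μ k)) c →
    (Q : ℕ) → IsLargest (λ j → 1 ℕ.≤ j × + r j ℤ.≤ c ℤ.- 1ℤ) Q →
    opt-IP[ k , μ ]≃ closedForm μ Q
-- For a ceiling c ≤ 0 the number c - 1 is negative, so it bounds no `r j`.
theorem2 k _ μ 1≤μ _ (+ zero)  _ Q ((_ , ()) , _)
theorem2 k _ μ 1≤μ _ -[1+ _ ] _ Q ((_ , ()) , _)
theorem2 k _ μ 1≤μ _ (+ suc m) (recip≤c , least) Q ((_ , ℤ.+≤+ rQ≤m) , largest) =
  closedForm-attained k Q μ rQ<k , maximal (suc m ℕ.<? k)
  where
  m<k : m ℕ.< k
  m<k = ℤ.drop‿+≤+ (least (+ k) (recip-threshold-≤k μ k))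
  rQ<k : r Q ℕ.< k
  rQ<k = ℕ.≤-<-trans rQ≤m m<k
  m<rQ⁺ : m ℕ.< r (suc Q)
  m<rQ⁺ = ℕ.≰⇒> λ r≤m → ℕ.<-irrefl refl (largest (suc Q) (s≤s z≤n , ℤ.+≤+ r≤m))
  -- If the reciprocal were at most `r Q`, minimality of the ceiling c would give c ≤ r(Q) ≤ c - 1.
  μ≤hi : μ ≤ᴿ fromℚ (1ℚ + u (r Q))
  μ≤hi = μ≤1+u μ k (r-pos Q) λ recip≤ →
    ℕ.<-irrefl refl (ℕ.≤-trans (ℤ.drop‿+≤+ (least (+ r Q) recip≤)) rQ≤m)
  -- If c = m + 1 < k, take `ℓ` = 1/c: kinds from r(Q+1) ≥ c on have value at most 1/c. Otherwise
  -- r(Q+1) ≥ k exceeds every kind, and `ℓ` = 0 works with 1 ≤ μ.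
  maximal : Dec (suc m ℕ.< k) → ∀ z → Feasible k z → objective k μ z ≤ᴿ closedForm μ Q
  maximal (yes c<k) = closedForm-maximal k Q μ rQ<k
    (0≤u (suc m)) (u-antitone (r-pos Q) (ℕ.m≤n⇒m≤1+n rQ≤m))
    (λ i ρQ≤i → u-antitone (s≤s z≤n) (ℕ.≤-trans m<rQ⁺ ρQ≤i))
    (1+u≤μ μ k (s≤s z≤n) c<k recip≤c) μ≤hi
  maximal (no c≮k) = closedForm-maximal k Q μ rQ<k
    ≤-refl (0≤u (r Q))
    (λ i ρQ≤i → contradiction (ℕ.≤-trans (toℕ<n i) (ℕ.pred-mono-≤ (ℕ.≮⇒≥ c≮k)))
                  (ℕ.<⇒≱ (ℕ.≤-trans m<rQ⁺ ρQ≤i)))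
    1≤μ μ≤hi
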